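{- Let $P\subset\mathbb{R}^d$ be a finite point set satisfying the standing condition, let $\varepsilon\in(0,1)$, let $X$ be the set of extreme points of $P$, let $Q^*_\varepsilon$ be an optimal solution of GRMR (a minimum-cardinality $\varepsilon$-regret set of $P$), and let $Q_\varepsilon$ be the solution returned by the algorithm H-GRMR described in the context. Then $|Q_\varepsilon|\le\frac{|X|}{d+1}\cdot|Q^*_\varepsilon|$.
   Context: For finite $Q\subset\mathbb{R}^d$ and unit $x$, $\omega(x,Q)=\max_{p\in Q}\langle p,x\rangle$. Standing condition: $\omega(x,P)>0$ for all $x\in\mathbb{S}^{d-1}$. Regret ratio $l_x(Q)=1-\omega(x,Q)/\omega(x,P)$; $l(Q)=\max_{x\in\mathbb{S}^{d-1}}l_x(Q)$; $Q\subseteq P$ is an $\varepsilon$-regret set if $l(Q)\le\varepsilon$; GRMR asks for a minimum-cardinality $\varepsilon$-regret set. Voronoi cell $R(p)=\{x\ne0:\langle p,x\rangle\ge\omega(x,P)\}$; extreme points $X=\{t_1,\dots,t_m\}$ are the points with $R(p)\ne\varnothing$. The inner-product Delaunay graph $\mathcal{G}(P)$ is the undirected graph on $X$ with an edge $\{t_i,t_j\}$ iff $R(t_i)\cap R(t_j)\ne\varnothing$; $N(t)$ denotes the neighbors of $t$. For $t_i,t_j\in X$, $\varepsilon_{ij}$ is the optimal value of the linear program: maximize $1-\langle t_i,x\rangle$ subject to $\langle t_j-t,x\rangle\ge0$ for all $t\in N(t_j)$ and $\langle t_j,x\rangle=1$ (with $\varepsilon_{ij}=+\infty$ if unbounded).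 Algorithm H-GRMR on input $(P,X,\mathcal{G}(P),\varepsilon)$: Step 1: start with a directed graph $H_\varepsilon$ on $X$ with no edges; for each $t_i$, mark $t_i$ visited, enqueue all of $N(t_i)$, and while the queue is nonempty dequeue $t_j$; if $t_j$ is not visited, mark it visited, compute $\varepsilon_{ij}$, and if $\varepsilon_{ij}\le\varepsilon$ add edge $t_i\to t_j$ and enqueue all of $N(t_j)$ (visited marks reset for each $t_i$). Step 2: let $Dom(t_i)=\{t_i\}\cup\{t_j: t_i\to t_j\in H_\varepsilon\}$; set $Q_\varepsilon=\varnothing$, $U=X$; while $U\ne\varnothing$, pick $t^*\in X\setminus Q_\varepsilon$ maximizing $|Dom(t^*)\cap U|$, add $t^*$ to $Q_\varepsilon$ and remove $Dom(t^*)$ from $U$. Return $Q_\varepsilon$. -}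

module Defs where

open import Level using (0ℓ)
open import Algebra.Bundles using (CommutativeRing)
open import Data.Nat.Base as ℕ using (ℕ)
open import Data.Fin.Base using (Fin)
open import Data.Fin.Subset using (Subset; _∈_; _∉_; _∩_; _∪_; _─_; ⁅_⁆; ⊤; ⊥; ∣_∣; Nonempty; Empty)
open import Data.List.Base using (List; []; _∷_; _++_)
import Data.List.Membership.Propositional as List
open import Data.List.Relation.Unary.Unique.Propositional using (Unique)
open import Data.Product.Base using (∃; ∃-syntax; _×_)
open import Data.Sum.Base using (_⊎_)
open import Data.Vec.Functional using (Vector; zipWith)
open import Data.Vec.Functional.Relation.Binary.Pointwise using (Pointwise)
open import Function.Bundles using (_⇔_)
open import Function.Definitions using (Injective)
open import Relation.Binary.Core using (Rel)
open import Relation.Binary.Structures using (IsStrictTotalOrder)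
open import Relation.Binary.PropositionalEquality.Core using (_≡_; _≢_)
open import Relation.Nullary.Negation.Core using (¬_)
open import Relation.Nullary.Construct.Add.Supremum using (_⁺; ⊤⁺; [_])
import Relation.Binary.Construct.Add.Supremum.NonStrict as AddSupremum
open import Relation.Unary using (Pred)

-- The real numbers, given by the axioms of a Dedekind-complete ordered field,
-- which determine them up to isomorphism.  Equality is a setoid equality, so
-- that Cauchy sequences of rationals are a model once excluded middle is
-- assumed.

record Reals : Set₁ where
  infix 4 _<_ _≤_
  infix 8 _⁻¹
  field
    commutativeRing : CommutativeRing 0ℓ 0ℓ

  open CommutativeRing commutativeRing public

  field
    -- The value of 0# ⁻¹ is left unspecified.
    _⁻¹                : Carrier → Carrier
    ⁻¹-inverse         : ∀ x → ¬ x ≈ 0# → x * x ⁻¹ ≈ 1#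
    _<_                : Rel Carrier 0ℓ
    isStrictTotalOrder : IsStrictTotalOrder _≈_ _<_
    0<1                : 0# < 1#
    +-monoˡ-<          : ∀ x y z → x < y → x + z < y + z
    *-positive         : ∀ x y → 0# < x → 0# < y → 0# < x * y

  _≤_ : Rel Carrier 0ℓ
  x ≤ y = x < y ⊎ x ≈ y

  UpperBound : Pred Carrier 0ℓ → Pred Carrier 0ℓ
  UpperBound S b = ∀ s → S s → s ≤ b

  field
    supremum : ∀ (S : Pred Carrier 0ℓ) → ∃ S → ∃ (UpperBound S) →
               ∃[ b ] UpperBound S b × (∀ c → UpperBound S c → b ≤ c)

  IsMaximum : Pred Carrier 0ℓ → Pred Carrier 0ℓ
  IsMaximum S m = S m × UpperBound S m

  open AddSupremum _≤_ public using (_≤⁺_)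

module Euclidean (ℝ : Reals) where
  open Reals ℝ
  open import Algebra.Definitions.RawMonoid +-rawMonoid using (sum)

  Space : ℕ → Set
  Space d = Vector Carrier d

  infix 4 _≋_
  _≋_ : ∀ {d} → Rel (Space d) 0ℓ
  _≋_ = Pointwise _≈_

  infixl 6 _⊖_
  _⊖_ : ∀ {d} → Space d → Space d → Space d
  _⊖_ = zipWith _-_

  ⟨_,_⟩ : ∀ {d} → Space d → Space d → Carrier
  ⟨ x , y ⟩ = sum (zipWith _*_ x y)

  NonzeroVector : ∀ {d} → Pred (Space d) 0ℓ
  NonzeroVector x = ¬ (x ≋ λ _ → 0#)

  Sphere : ∀ {d} → Pred (Space d) 0ℓ
  Sphere x = ⟨ x , x ⟩ ≈ 1#

-- A finite point set is an injective family t : Fin n → Space d; subsets of it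
-- are sets of indices, so P itself is ⊤.  Quantities defined by a maximum are
-- relations to their value, since the maximum of an empty set does not exist.

module Regret (ℝ : Reals) {d n : ℕ} (t : Fin n → Euclidean.Space ℝ d) where
  open Reals ℝ
  open Euclidean ℝ

  Distinct : Set
  Distinct = Injective _≡_ _≋_ t

  -- w = ω(x,Q)
  Isω : Space d → Subset n → Pred Carrier 0ℓ
  Isω x Q = IsMaximum λ v → ∃[ i ] i ∈ Q × v ≈ ⟨ t i , x ⟩

  StandingCondition : Set
  StandingCondition = ∀ x → Sphere x → ∃[ w ] Isω x ⊤ w × 0# < w

  -- r = l_x(Q)
  IsRegretRatio : Space d → Subset n → Pred Carrier 0ℓ
  IsRegretRatio x Q r =
    ∃[ w ] ∃[ wₚ ] Isω x Q w × Isω x ⊤ wₚ × r ≈ 1# - w * wₚ ⁻¹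

  -- l = l(Q)
  IsMaxRegretRatio : Subset n → Pred Carrier 0ℓ
  IsMaxRegretRatio Q = IsMaximum λ r → ∃[ x ] Sphere x × IsRegretRatio x Q r

  IsRegretSet : Carrier → Pred (Subset n) 0ℓ
  IsRegretSet ε Q = ∃[ l ] IsMaxRegretRatio Q l × l ≤ ε

  IsOptimal : Carrier → Pred (Subset n) 0ℓ
  IsOptimal ε Q =
    IsRegretSet ε Q × (∀ Q′ → IsRegretSet ε Q′ → ∣ Q ∣ ℕ.≤ ∣ Q′ ∣)

  VoronoiCell : Fin n → Pred (Space d) 0ℓ
  VoronoiCell i x = NonzeroVector x × ∃[ w ] Isω x ⊤ w × w ≤ ⟨ t i , x ⟩

  IsExtremeSet : Pred (Subset n) 0ℓ
  IsExtremeSet X = ∀ i → i ∈ X ⇔ ∃ (VoronoiCell i)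

  -- N assigns to each point its set of neighbours.
  IsDelaunayGraph : Subset n → (Fin n → Subset n) → Set
  IsDelaunayGraph X N = ∀ i j → j ∈ N i ⇔
    (i ∈ X × j ∈ X × i ≢ j × ∃[ x ] VoronoiCell i x × VoronoiCell j x)

  Enumerates : List (Fin n) → Subset n → Set
  Enumerates js S = Unique js × (∀ j → j List.∈ js ⇔ j ∈ S)

  module HGRMR (X : Subset n) (N : Fin n → Subset n) (ε : Carrier) where

    Feasible : Fin n → Pred (Space d) 0ℓ
    Feasible j x = (∀ k → k ∈ N j → 0# ≤ ⟨ t j ⊖ t k , x ⟩) × ⟨ t j , x ⟩ ≈ 1#

    Objective : Fin n → Fin n → Pred Carrier 0ℓ
    Objective i j v = ∃[ x ] Feasible j x × v ≈ 1# - ⟨ t i , x ⟩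

    -- e = ε_ij
    IsLPValue : Fin n → Fin n → Pred (Carrier ⁺) 0ℓ
    IsLPValue i j [ v ] = IsMaximum (Objective i j) v
    IsLPValue i j ⊤⁺    = ∀ b → ∃[ v ] Objective i j v × b < v

    -- Search i q V D D′: the loop for source i, run from queue q, visited set V
    -- and current out-neighbours D of i, ends with out-neighbours D′.  Any
    -- order of enqueuing is allowed.
    data Search (i : Fin n) :
         List (Fin n) → Subset n → Subset n → Subset n → Set where
      done   : ∀ {V D} → Search i [] V D D
      skip   : ∀ {j q V D D′} → j ∈ V →
               Search i q V D D′ →
               Search i (j ∷ q) V D D′
      accept : ∀ {j q V D D′} (e : Carrier ⁺) (js : List (Fin n)) →
               j ∉ V → IsLPValue i j e → e ≤⁺ [ ε ] →
               Enumerates js (N j) →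
               Search i (q ++ js) (V ∪ ⁅ j ⁆) (D ∪ ⁅ j ⁆) D′ →
               Search i (j ∷ q) V D D′
      reject : ∀ {j q V D D′} (e : Carrier ⁺) →
               j ∉ V → IsLPValue i j e → ¬ e ≤⁺ [ ε ] →
               Search i q (V ∪ ⁅ j ⁆) D D′ →
               Search i (j ∷ q) V D D′

    -- H i is the set of out-neighbours of i in the directed graph H_ε on X.
    Step1 : (Fin n → Subset n) → Set
    Step1 H =
      (∀ i → i ∈ X → ∃[ js ] Enumerates js (N i) × Search i js ⁅ i ⁆ ⊥ (H i)) ×
      (∀ i → i ∉ X → H i ≡ ⊥)

    Dom : (Fin n → Subset n) → Fin n → Subset n
    Dom H i = ⁅ i ⁆ ∪ H i

    -- Greedy H Q U Q′: the covering loop, run from partial solution Q and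
    -- uncovered set U, returns Q′.  Ties are broken arbitrarily.
    data Greedy (H : Fin n → Subset n) :
         Subset n → Subset n → Subset n → Set where
      done : ∀ {Q U} → Empty U → Greedy H Q U Q
      pick : ∀ {Q U Q′} (i : Fin n) →
             Nonempty U → i ∈ X → i ∉ Q →
             (∀ k → k ∈ X → k ∉ Q → ∣ Dom H k ∩ U ∣ ℕ.≤ ∣ Dom H i ∩ U ∣) →
             Greedy H (Q ∪ ⁅ i ⁆) (U ─ Dom H i) Q′ →
             Greedy H Q U Q′

    Returns : Pred (Subset n) 0ℓ
    Returns Q = ∃[ H ] Step1 H × Greedy H ⊥ X Q

{-# OPTIONS --safe #-}

-- The greedy loop only picks extreme points, so |Qε| ≤ |X|, and it suffices
-- that an ε-regret set Q with ε < 1 has at least d + 1 points.  If |Q| ≤ d,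
-- remove some q from Q; the remaining points, fewer than d, are orthogonal to
-- some unit vector x, whose sign can be chosen so that ⟨q,x⟩ ≤ 0.  Then
-- ω(x,Q) ≤ 0 < ω(x,P), so the regret ratio at x is at least 1 > ε.

module Submission where

open import Defs
open import Data.Nat.Base as ℕ using (ℕ; suc)
import Data.Nat.Properties as ℕ
open import Data.Bool.Base using (true; false)
open import Data.Fin.Base using (Fin; zero; suc)
open import Data.Fin.Properties using (any?; _≟_)
open import Data.Fin.Subset using (Subset; ∣_∣; _∈_; _⊆_; ⁅_⁆; Nonempty) renaming (_-_ to _∖_)
open import Data.Fin.Subset.Properties using (_∈?_; nonempty?; p⊆q⇒∣p∣≤∣q∣; x∈p⇒∣p-x∣<∣p∣; x∈p∧x≢y⇒x∈p-y; x∈p∪q⁻; x∈⁅y⁆⇒x≡y; ∉⊥)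
open import Data.Integer.Base as ℤ using (+_)
import Data.Integer.Properties as ℤ
open import Data.Product.Base using (∃-syntax; _×_; _,_)
import Data.Rational.Base as ℚ
import Data.Rational.Properties as ℚ
import Data.Rational.Unnormalised.Base as ℚᵘ
import Data.Rational.Unnormalised.Properties as ℚᵘ
open import Data.Sum.Base using (_⊎_; inj₁; inj₂; [_,_]′)
open import Data.Vec.Base using (_∷_; here; there)
open import Data.Vec.Functional using (head; tail)
open import Function.Base using (_∘_)
open import Level using (0ℓ)
open import Relation.Binary.Bundles using (StrictTotalOrder)
open import Relation.Binary.Definitions using (tri<; tri≈; tri>)
open import Relation.Binary.PropositionalEquality.Core as ≡ using ()
open import Relation.Nullary.Decidable using (yes; no; ¬?; _×-dec_; decidable-stable)
open import Relation.Nullary.Negation.Core using (¬_; contradiction)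

-- Arithmetic and order in a Dedekind-complete ordered field.

module OrderedField (ℝ : Reals) where
  open Reals ℝ hiding (zero)
  open import Algebra.Properties.Ring ring using (-‿distribˡ-*; -‿distribʳ-*)
  open import Algebra.Properties.Group +-group using (⁻¹-involutive; ∙-cancelʳ)
  open import Algebra.Solver.Ring.NaturalCoefficients.Default commutativeSemiring using (solve; _:=_; _:+_; _:*_; con)
  open import Relation.Binary.Reasoning.Setoid setoid

  strictTotalOrder : StrictTotalOrder 0ℓ 0ℓ 0ℓ
  strictTotalOrder = record { isStrictTotalOrder = isStrictTotalOrder }

  open StrictTotalOrder strictTotalOrder public
    using (compare; irrefl; <-respʳ-≈; <-respˡ-≈)
    renaming (_≟_ to _≈?_; trans to <-trans)
  open import Relation.Binary.Properties.StrictTotalOrder strictTotalOrder public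
    using (total; ≤-respʳ-≈; ≤-respˡ-≈)
    renaming (trans to ≤-trans; reflexive to ≤-reflexive; refl to ≤-refl)

  ≤-<-trans : ∀ {x y z} → x ≤ y → y < z → x < z
  ≤-<-trans (inj₁ x<y) y<z = <-trans x<y y<z
  ≤-<-trans (inj₂ x≈y) y<z = <-respˡ-≈ (sym x≈y) y<z

  <⇒≱ : ∀ {x y} → x < y → ¬ y ≤ x
  <⇒≱ x<y y≤x = irrefl refl (≤-<-trans y≤x x<y)

  ≮⇒≥ : ∀ {x y} → ¬ x < y → y ≤ x
  ≮⇒≥ {x} {y} x≮y with compare x y
  ... | tri< x<y _ _ = contradiction x<y x≮y
  ... | tri≈ _ x≈y _ = inj₂ (sym x≈y)
  ... | tri> _ _ y<x = inj₁ y<x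

  x<x+y : ∀ {x y} → 0# < y → x < x + y
  x<x+y {x} {y} 0<y = <-respˡ-≈ (+-identityˡ x) (<-respʳ-≈ (+-comm y x) (+-monoˡ-< 0# y x 0<y))

  x≤x+y : ∀ {x y} → 0# ≤ y → x ≤ x + y
  x≤x+y {x} (inj₁ 0<y) = inj₁ (x<x+y 0<y)
  x≤x+y {x} (inj₂ 0≈y) = inj₂ (trans (sym (+-identityʳ x)) (+-congˡ 0≈y))

  -- Abstract, here and below, because `with` would otherwise normalise the
  -- equality proofs produced by the solver.
  abstract
    <⇒difference : ∀ {x y} → x < y → ∃[ e ] 0# < e × y ≈ x + e
    <⇒difference {x} {y} x<y = y - x , <-respˡ-≈ (-‿inverseʳ x) (+-monoˡ-< x y (- x) x<y) , (begin
      y               ≈⟨ +-identityʳ y ⟨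
      y + 0#          ≈⟨ +-congˡ (-‿inverseʳ x) ⟨
      y + (x - x)     ≈⟨ solve 3 (λ x y z → y :+ (x :+ z) := x :+ (y :+ z)) refl x y (- x) ⟩
      x + (y - x)     ∎)

  -- Inequalities are traded for equations with a nonnegative summand, because the semiring solver
  -- knows no subtraction.
  ≤⇒difference : ∀ {x y} → x ≤ y → ∃[ e ] 0# ≤ e × y ≈ x + e
  ≤⇒difference (inj₁ x<y) with e , 0<e , y≈x+e ← <⇒difference x<y = e , inj₁ 0<e , y≈x+e
  ≤⇒difference {x} (inj₂ x≈y) = 0# , ≤-refl , trans (sym x≈y) (sym (+-identityʳ x))

  +-positive : ∀ {x y} → 0# < x → 0# ≤ y → 0# < x + y
  +-positive 0<x (inj₁ 0<y) = <-trans 0<x (x<x+y 0<y)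
  +-positive {x} 0<x (inj₂ 0≈y) = <-respʳ-≈ (trans (sym (+-identityʳ x)) (+-congˡ 0≈y)) 0<x

  +-nonneg : ∀ {x y} → 0# ≤ x → 0# ≤ y → 0# ≤ x + y
  +-nonneg 0≤x 0≤y = ≤-trans 0≤x (x≤x+y 0≤y)

  *-nonneg : ∀ {x y} → 0# ≤ x → 0# ≤ y → 0# ≤ x * y
  *-nonneg {x} {y} (inj₁ 0<x) (inj₁ 0<y) = inj₁ (*-positive x y 0<x 0<y)
  *-nonneg {x} {y} (inj₁ 0<x) (inj₂ 0≈y) = inj₂ (trans (sym (zeroʳ x)) (*-congˡ 0≈y))
  *-nonneg {x} {y} (inj₂ 0≈x) _          = inj₂ (trans (sym (zeroˡ y)) (*-congʳ 0≈x))

  neg-nonneg : ∀ {x} → x ≤ 0# → 0# ≤ - x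
  neg-nonneg {x} x≤0 with e , 0≤e , 0≈x+e ← ≤⇒difference x≤0 = ≤-respʳ-≈ e≈-x 0≤e
    where
    e≈-x : e ≈ - x
    e≈-x = begin
      e               ≈⟨ +-identityˡ e ⟨
      0# + e          ≈⟨ +-congʳ (-‿inverseˡ x) ⟨
      (- x + x) + e   ≈⟨ +-assoc (- x) x e ⟩
      - x + (x + e)   ≈⟨ +-congˡ 0≈x+e ⟨
      - x + 0#        ≈⟨ +-identityʳ (- x) ⟩
      - x             ∎

  neg-nonpositive : ∀ {x} → 0# ≤ x → - x ≤ 0#
  neg-nonpositive {x} 0≤x = ≤-respʳ-≈ (-‿inverseˡ x) (x≤x+y 0≤x)

  -x*-x≈x*x : ∀ x → - x * - x ≈ x * x
  -x*-x≈x*x x = begin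
    - x * - x      ≈⟨ -‿distribˡ-* x (- x) ⟨
    - (x * - x)    ≈⟨ -‿cong (-‿distribʳ-* x x) ⟨
    - - (x * x)    ≈⟨ ⁻¹-involutive (x * x) ⟩
    x * x          ∎

  square-nonneg : ∀ x → 0# ≤ x * x
  square-nonneg x with total 0# x
  ... | inj₁ 0≤x = *-nonneg 0≤x 0≤x
  ... | inj₂ x≤0 = ≤-respʳ-≈ (-x*-x≈x*x x) (*-nonneg (neg-nonneg x≤0) (neg-nonneg x≤0))

  square-positive : ∀ x → ¬ x ≈ 0# → 0# < x * x
  square-positive x x≉0 with square-nonneg x
  ... | inj₁ 0<x² = 0<x²
  ... | inj₂ 0≈x² = contradiction (begin
    x                    ≈⟨ *-identityʳ x ⟨
    x * 1#               ≈⟨ *-congˡ (⁻¹-inverse x x≉0) ⟨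
    x * (x * x ⁻¹)       ≈⟨ *-assoc x x (x ⁻¹) ⟨
    (x * x) * x ⁻¹       ≈⟨ *-congʳ 0≈x² ⟨
    0# * x ⁻¹            ≈⟨ zeroˡ (x ⁻¹) ⟩
    0#                   ∎) x≉0

  positive⇒nonzero : ∀ {x} → 0# < x → ¬ x ≈ 0#
  positive⇒nonzero 0<x x≈0 = irrefl (sym x≈0) 0<x

  ⁻¹-positive : ∀ {x} → 0# < x → 0# < x ⁻¹
  ⁻¹-positive {x} 0<x with compare 0# (x ⁻¹)
  ... | tri< 0<x⁻¹ _ _ = 0<x⁻¹
  ... | tri≈ _ 0≈x⁻¹ _ = contradiction 0<1 (irrefl (begin
    0#           ≈⟨ zeroʳ x ⟨
    x * 0#       ≈⟨ *-congˡ 0≈x⁻¹ ⟩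
    x * x ⁻¹     ≈⟨ ⁻¹-inverse x (positive⇒nonzero 0<x) ⟩
    1#           ∎))
  -- A negative inverse would make `x * - (x ⁻¹)` a product of nonnegative factors, yet it equals
  -- `- 1#`.
  ... | tri> _ _ x⁻¹<0 = contradiction 0≤-1 (<⇒≱ -1<0)
    where
    0≤-1 : 0# ≤ - 1#
    0≤-1 = ≤-respʳ-≈
      (trans (sym (-‿distribʳ-* x (x ⁻¹))) (-‿cong (⁻¹-inverse x (positive⇒nonzero 0<x))))
      (*-nonneg (inj₁ 0<x) (neg-nonneg (inj₁ x⁻¹<0)))
    -1<0 : - 1# < 0#
    -1<0 = <-respʳ-≈ (-‿inverseˡ 1#) (x<x+y 0<1)

  divide-multiply : ∀ x {y} → 0# < y → (x * y ⁻¹) * y ≈ x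
  divide-multiply x {y} 0<y = begin
    (x * y ⁻¹) * y   ≈⟨ solve 3 (λ x y i → (x :* i) :* y := x :* (y :* i)) refl x y (y ⁻¹) ⟩
    x * (y * y ⁻¹)   ≈⟨ *-congˡ (⁻¹-inverse y (positive⇒nonzero 0<y)) ⟩
    x * 1#           ≈⟨ *-identityʳ x ⟩
    x                ∎

  -- Square roots as suprema.

  square-mono-< : ∀ {x y} → 0# ≤ x → x < y → x * x < y * y
  square-mono-< {x} {y} 0≤x x<y with e , 0<e , y≈x+e ← <⇒difference x<y =
    <-respʳ-≈ (begin
      x * x + e * (e + (x + x))
        ≈⟨ solve 2 (λ x e → x :* x :+ e :* (e :+ (x :+ x)) := (x :+ e) :* (x :+ e)) refl x e ⟩
      (x + e) * (x + e)            ≈⟨ *-cong y≈x+e y≈x+e ⟨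
      y * y                        ∎)
      (x<x+y (*-positive e _ 0<e (+-positive 0<e (+-nonneg 0≤x 0≤x))))

  module _ {a b : Carrier} (0≤b : 0# ≤ b) where

    private
      b+b≥0 : 0# ≤ b + b
      b+b≥0 = +-nonneg 0≤b 0≤b

    abstract
      -- With a = b² + e, the increment δ = e / (1 + 2b + e) works.
      increase-root : b * b < a → ∃[ δ ] 0# < δ × (b + δ) * (b + δ) < a
      increase-root b²<a with e , 0<e , a≈b²+e ← <⇒difference b²<a =
        δ , 0<δ , <-respʳ-≈ (sym a≈[b+δ]²+r) (x<x+y 0<r)
        where
        k m δ r : Carrier
        k = e + (b + b)
        m = 1# + k
        δ = e * m ⁻¹
        -- The surplus of `a` over the square of `b + δ`. Substituting `δ * m` for `e` twice
        -- produces the term `δ * δ` that completes the square, and `r` is what remains.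
        r = δ * (1# + δ * k)
        0<k : 0# < k
        0<k = +-positive 0<e b+b≥0
        0<m : 0# < m
        0<m = +-positive 0<1 (inj₁ 0<k)
        0<δ : 0# < δ
        0<δ = *-positive e _ 0<e (⁻¹-positive 0<m)
        0<r : 0# < r
        0<r = *-positive δ _ 0<δ (+-positive 0<1 (inj₁ (*-positive δ k 0<δ 0<k)))
        e≈δm : e ≈ δ * m
        e≈δm = sym (divide-multiply e 0<m)
        a≈[b+δ]²+r : a ≈ (b + δ) * (b + δ) + r
        a≈[b+δ]²+r = begin
          a                                              ≈⟨ a≈b²+e ⟩
          b * b + e                                      ≈⟨ +-congˡ e≈δm ⟩
          b * b + δ * (1# + (e + (b + b)))
            ≈⟨ solve 3 (λ b e δ → b :* b :+ δ :* (con 1 :+ (e :+ (b :+ b)))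
                               := b :* b :+ δ :* (con 1 :+ (b :+ b)) :+ δ :* e) refl b e δ ⟩
          b * b + δ * (1# + (b + b)) + δ * e             ≈⟨ +-congˡ (*-congˡ e≈δm) ⟩
          b * b + δ * (1# + (b + b)) + δ * (δ * (1# + k))
            ≈⟨ solve 3 (λ b k δ → b :* b :+ δ :* (con 1 :+ (b :+ b)) :+ δ :* (δ :* (con 1 :+ k))
                               := (b :+ δ) :* (b :+ δ) :+ δ :* (con 1 :+ δ :* k)) refl b k δ ⟩
          (b + δ) * (b + δ) + r                          ∎

      -- With b² = a + e, the decrement δ = e / 2b works.
      decrease-root : 0# < b → a < b * b →
                      ∃[ q ] q < b × (∀ s → s ≤ b → s * s ≤ a → s ≤ q)
      decrease-root 0<b a<b² with e , 0<e , b²≈a+e ← <⇒difference a<b² =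
        q , <-respʳ-≈ (sym b≈q+δ) (x<x+y 0<δ) , λ s s≤b s²≤a → ≮⇒≥ (λ q<s → <⇒≱ (a<s² s s≤b q<s) s²≤a)
        where
        m δ q : Carrier
        m = b + b
        δ = e * m ⁻¹
        q = b - δ
        0<m : 0# < m
        0<m = +-positive 0<b 0≤b
        0<δ : 0# < δ
        0<δ = *-positive e _ 0<e (⁻¹-positive 0<m)
        e≈δm : e ≈ δ * m
        e≈δm = sym (divide-multiply e 0<m)
        b≈q+δ : b ≈ q + δ
        b≈q+δ = begin
          b                ≈⟨ +-identityʳ b ⟨
          b + 0#           ≈⟨ +-congˡ (-‿inverseˡ δ) ⟨
          b + (- δ + δ)    ≈⟨ +-assoc b (- δ) δ ⟨
          q + δ            ∎
        -- Here `b ≈ s + σ` and `s ≈ q + f`, so `δ ≈ f + σ` and `e ≈ (f + σ) * m` with `m = b + b`.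
        -- Hence `s * s` exceeds `a` by `f * m + σ * σ`. The computation carries `e` on both sides
        -- to avoid subtraction and cancels it at the end.
        a<s² : ∀ s → s ≤ b → q < s → a < s * s
        a<s² s s≤b q<s with σ , 0≤σ , b≈s+σ ← ≤⇒difference s≤b | f , 0<f , s≈q+f ← <⇒difference q<s =
          <-respʳ-≈ (sym (∙-cancelʳ e _ _ s²+e≈)) (x<x+y (+-positive (*-positive f m 0<f 0<m) (square-nonneg σ)))
          where
          δ≈f+σ : δ ≈ f + σ
          δ≈f+σ = ∙-cancelʳ q _ _ (begin
            δ + q        ≈⟨ +-comm δ q ⟩
            q + δ        ≈⟨ b≈q+δ ⟨
            b            ≈⟨ b≈s+σ ⟩
            s + σ        ≈⟨ +-congʳ s≈q+f ⟩
            (q + f) + σ  ≈⟨ solve 3 (λ q f σ → (q :+ f) :+ σ := (f :+ σ) :+ q) refl q f σ ⟩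
            (f + σ) + q  ∎)
          s²+e≈ : s * s + e ≈ (a + (f * m + σ * σ)) + e
          s²+e≈ = begin
            s * s + e                            ≈⟨ +-congˡ e≈δm ⟩
            s * s + δ * m                        ≈⟨ +-congˡ (*-congʳ δ≈f+σ) ⟩
            s * s + (f + σ) * m
              ≈⟨ solve 4 (λ s f σ m → s :* s :+ (f :+ σ) :* m := s :* s :+ σ :* m :+ f :* m) refl s f σ m ⟩
            s * s + σ * (b + b) + f * m          ≈⟨ +-congʳ (+-congˡ (*-congˡ (+-cong b≈s+σ b≈s+σ))) ⟩
            s * s + σ * ((s + σ) + (s + σ)) + f * m
              ≈⟨ solve 3 (λ s σ g → s :* s :+ σ :* ((s :+ σ) :+ (s :+ σ)) :+ g
                                 := (s :+ σ) :* (s :+ σ) :+ (g :+ σ :* σ)) refl s σ (f * m) ⟩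
            (s + σ) * (s + σ) + (f * m + σ * σ)  ≈⟨ +-congʳ (*-cong b≈s+σ b≈s+σ) ⟨
            b * b + (f * m + σ * σ)              ≈⟨ +-congʳ b²≈a+e ⟩
            (a + e) + (f * m + σ * σ)
              ≈⟨ solve 3 (λ a e g → (a :+ e) :+ g := (a :+ g) :+ e) refl a e (f * m + σ * σ) ⟩
            (a + (f * m + σ * σ)) + e            ∎

  -- For positive `a` this is the interval between its two square roots, so its supremum is the
  -- positive one.
  Subroot : Carrier → Carrier → Set
  Subroot a s = s * s ≤ a

  zero-Subroot : ∀ {a} → 0# < a → Subroot a 0#
  zero-Subroot 0<a = inj₁ (<-respˡ-≈ (sym (zeroˡ 0#)) 0<a)

  -- The bound `a + 1#` serves small and large `a` alike, since its square is `a` plus positive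
  -- terms.
  Subroot-bounded : ∀ {a} → 0# < a → UpperBound (Subroot a) (a + 1#)
  Subroot-bounded {a} 0<a s s²≤a = ≮⇒≥ λ a+1<s →
    <⇒≱ (<-trans a<[a+1]² (square-mono-< (inj₁ 0<a+1) a+1<s)) s²≤a
    where
    0<a+1 : 0# < a + 1#
    0<a+1 = +-positive 0<a (inj₁ 0<1)
    a<[a+1]² : a < (a + 1#) * (a + 1#)
    a<[a+1]² = <-respʳ-≈
      (solve 1 (λ a → a :+ ((a :+ con 1) :+ a :* a) := (a :+ con 1) :* (a :+ con 1)) refl a)
      (x<x+y (+-positive 0<a+1 (square-nonneg a)))

  -- Trichotomy: if `b * b < a`, then `increase-root` gives a member of the set above `b`; if
  -- `a < b * b`, then `decrease-root` gives an upper bound below `b`.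
  Subroot-supremum : ∀ {a b} → 0# < a → UpperBound (Subroot a) b →
                     (∀ c → UpperBound (Subroot a) c → b ≤ c) → 0# < b × b * b ≈ a
  Subroot-supremum {a} {b} 0<a upper least = 0<b , b²≈a
    where
    0≤b : 0# ≤ b
    0≤b = upper 0# (zero-Subroot 0<a)

    b²≮a : ¬ b * b < a
    b²≮a b²<a with δ , 0<δ , [b+δ]²<a ← increase-root 0≤b b²<a =
      <⇒≱ (x<x+y 0<δ) (upper (b + δ) (inj₁ [b+δ]²<a))

    -- If `b` were zero, its square would lie below `a`, which is already excluded. Positivity is
    -- settled here because `decrease-root` divides by `b + b`.
    0<b : 0# < b
    0<b with 0≤b
    ... | inj₁ 0<b = 0<b
    ... | inj₂ 0≈b = contradiction (<-respˡ-≈ (trans (sym (zeroʳ b)) (*-congˡ 0≈b)) 0<a) b²≮a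

    b²≈a : b * b ≈ a
    b²≈a with compare (b * b) a
    ... | tri< b²<a _ _ = contradiction b²<a b²≮a
    ... | tri≈ _ b²≈a _ = b²≈a
    ... | tri> _ _ a<b² with q , q<b , bounds ← decrease-root 0≤b 0<b a<b² =
      contradiction (least q (λ s s²≤a → bounds s (upper s s²≤a) s²≤a)) (<⇒≱ q<b)

  abstract
    sqrt : ∀ {a} → 0# < a → ∃[ b ] 0# < b × b * b ≈ a
    sqrt {a} 0<a =
      let b , upper , least = supremum (Subroot a) (0# , zero-Subroot 0<a) (a + 1# , Subroot-bounded 0<a)
      in b , Subroot-supremum 0<a upper least

  -- Maxima over finite subsets.

  maximum : ∀ {n} (f : Fin n → Carrier) (Q : Subset n) → Nonempty Q →
            ∃[ i ] i ∈ Q × (∀ j → j ∈ Q → f j ≤ f i)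
  maximum f (false ∷ Q) (suc k , there k∈Q)
    with i , i∈Q , max ← maximum (f ∘ suc) Q (k , k∈Q) =
    suc i , there i∈Q , λ { (suc j) (there j∈Q) → max j j∈Q }
  maximum f (true ∷ Q) _ with nonempty? Q
  ... | no  Q-empty = zero , here , λ
    { zero    _           → ≤-refl
    ; (suc j) (there j∈Q) → contradiction (j , j∈Q) Q-empty }
  ... | yes Q-nonempty with i , i∈Q , max ← maximum (f ∘ suc) Q Q-nonempty
    with total (f zero) (f (suc i))
  ... | inj₁ f0≤fi = suc i , there i∈Q , λ
    { zero    _           → f0≤fi
    ; (suc j) (there j∈Q) → max j j∈Q }
  ... | inj₂ fi≤f0 = zero , here , λ
    { zero    _           → ≤-refl
    ; (suc j) (there j∈Q) → ≤-trans (max j j∈Q) fi≤f0 }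

-- Inner products, unit vectors and orthogonality.

module InnerProduct (ℝ : Reals) where
  open Reals ℝ hiding (zero)
  open Euclidean ℝ
  open OrderedField ℝ
  open import Algebra.Properties.Ring ring using (-‿distribˡ-*; -‿distribʳ-*; -1*x≈-x)
  open import Algebra.Solver.Ring.NaturalCoefficients.Default commutativeSemiring using (solve; _:=_; _:+_; _:*_; con)
  open import Relation.Binary.Reasoning.Setoid setoid

  infixr 7 _·_
  _·_ : ∀ {d} → Carrier → Space d → Space d
  (c · x) k = c * x k

  infixl 6 _⊕_
  _⊕_ : ∀ {d} → Space d → Space d → Space d
  (x ⊕ y) k = x k + y k

  inner-comm : ∀ {d} (x y : Space d) → ⟨ x , y ⟩ ≈ ⟨ y , x ⟩
  inner-comm {ℕ.zero} x y = refl
  inner-comm {suc d}  x y = +-cong (*-comm _ _) (inner-comm (tail x) (tail y))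

  inner-zeroʳ : ∀ {d} (x : Space d) → ⟨ x , (λ _ → 0#) ⟩ ≈ 0#
  inner-zeroʳ {ℕ.zero} x = refl
  inner-zeroʳ {suc d}  x = trans (+-cong (zeroʳ _) (inner-zeroʳ (tail x))) (+-identityˡ 0#)

  -- Linearity in the shape of a row operation, as the elimination below applies it.
  inner-⊕-·ˡ : ∀ {d} (x : Space d) c (y z : Space d) →
               ⟨ x ⊕ c · y , z ⟩ ≈ ⟨ x , z ⟩ + c * ⟨ y , z ⟩
  inner-⊕-·ˡ {ℕ.zero} x c y z = solve 1 (λ c → con 0 := con 0 :+ c :* con 0) refl c
  inner-⊕-·ˡ {suc d}  x c y z = trans (+-congˡ (inner-⊕-·ˡ (tail x) c (tail y) (tail z)))
    (solve 6 (λ x c y z s t → (x :+ c :* y) :* z :+ (s :+ c :* t)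
                           := (x :* z :+ s) :+ c :* (y :* z :+ t)) refl
      (head x) c (head y) (head z) ⟨ tail x , tail z ⟩ ⟨ tail y , tail z ⟩)

  inner-·ʳ : ∀ {d} (x : Space d) c (y : Space d) → ⟨ x , c · y ⟩ ≈ c * ⟨ x , y ⟩
  inner-·ʳ {ℕ.zero} x c y = sym (zeroʳ c)
  inner-·ʳ {suc d}  x c y = trans (+-congˡ (inner-·ʳ (tail x) c (tail y)))
    (solve 4 (λ x c y t → x :* (c :* y) :+ c :* t := c :* (x :* y :+ t)) refl
      (head x) c (head y) ⟨ tail x , tail y ⟩)

  inner-·· : ∀ {d} c (x : Space d) → ⟨ c · x , c · x ⟩ ≈ (c * c) * ⟨ x , x ⟩
  inner-·· c x = begin
    ⟨ c · x , c · x ⟩        ≈⟨ inner-·ʳ (c · x) c x ⟩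
    c * ⟨ c · x , x ⟩        ≈⟨ *-congˡ (inner-comm (c · x) x) ⟩
    c * ⟨ x , c · x ⟩        ≈⟨ *-congˡ (inner-·ʳ x c x) ⟩
    c * (c * ⟨ x , x ⟩)      ≈⟨ *-assoc c c _ ⟨
    (c * c) * ⟨ x , x ⟩      ∎

  -- A sum of squares is positive once one coordinate is nonzero; trichotomy of the order lets each
  -- coordinate be tested against zero.
  zero-or-positive : ∀ {d} (x : Space d) → x ≋ (λ _ → 0#) ⊎ 0# < ⟨ x , x ⟩
  zero-or-positive {ℕ.zero} x = inj₁ λ ()
  zero-or-positive {suc d}  x with zero-or-positive (tail x) | head x ≈? 0#
  ... | inj₂ 0<‖x‖² | _       = inj₂ (<-respʳ-≈ (+-comm _ _) (+-positive 0<‖x‖² (square-nonneg (head x))))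
  ... | inj₁ x≋0    | yes x≈0 = inj₁ λ { zero → x≈0 ; (suc k) → x≋0 k }
  ... | inj₁ x≋0    | no  x≉0 = inj₂ (+-positive (square-positive _ x≉0) (inner-nonneg (tail x)))
    where
    inner-nonneg : ∀ {d} (x : Space d) → 0# ≤ ⟨ x , x ⟩
    inner-nonneg {ℕ.zero} x = ≤-refl
    inner-nonneg {suc d}  x = +-nonneg (square-nonneg (head x)) (inner-nonneg (tail x))

  -- The result is a scalar rather than a new vector, so that orthogonality carries over by
  -- homogeneity and the sign can still be flipped.
  normalise : ∀ {d} (x : Space d) → NonzeroVector x → ∃[ c ] Sphere (c · x)
  normalise x x≉0 with zero-or-positive x
  ... | inj₁ x≋0 = contradiction x≋0 x≉0
  ... | inj₂ 0<‖x‖² with s , 0<s , s²≈‖x‖² ← sqrt 0<‖x‖² = s ⁻¹ , (begin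
    ⟨ s ⁻¹ · x , s ⁻¹ · x ⟩      ≈⟨ inner-·· (s ⁻¹) x ⟩
    (s ⁻¹ * s ⁻¹) * ⟨ x , x ⟩    ≈⟨ *-congˡ s²≈‖x‖² ⟨
    (s ⁻¹ * s ⁻¹) * (s * s)
      ≈⟨ solve 2 (λ i s → (i :* i) :* (s :* s) := (s :* i) :* (s :* i)) refl (s ⁻¹) s ⟩
    (s * s ⁻¹) * (s * s ⁻¹)      ≈⟨ *-cong s*s⁻¹≈1 s*s⁻¹≈1 ⟩
    1# * 1#                      ≈⟨ *-identityˡ 1# ⟩
    1#                           ∎)
    where s*s⁻¹≈1 = ⁻¹-inverse s (positive⇒nonzero 0<s)

  -- Gaussian elimination of the first coordinate, by a row p with v p 0 ≠ 0.
  nonzero-orthogonal : ∀ {d n} (v : Fin n → Space d) (Q : Subset n) → ∣ Q ∣ ℕ.< d →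
                       ∃[ x ] NonzeroVector x × (∀ i → i ∈ Q → ⟨ v i , x ⟩ ≈ 0#)
  -- Dimension zero has no clause, since no cardinality is below zero.
  nonzero-orthogonal {suc d} v Q ∣Q∣<1+d
    with any? (λ p → p ∈? Q ×-dec ¬? (head (v p) ≈? 0#))
  -- Every vector indexed by `Q` vanishes in the first coordinate, so the first basis vector is
  -- orthogonal to all of them.
  ... | no no-pivot = e₀ , (λ e₀≋0 → irrefl (sym (e₀≋0 zero)) 0<1) , orthogonal
    where
    e₀ : Space (suc d)
    e₀ zero    = 1#
    e₀ (suc _) = 0#
    orthogonal : ∀ i → i ∈ Q → ⟨ v i , e₀ ⟩ ≈ 0#
    orthogonal i i∈Q = begin
      head (v i) * 1# + ⟨ tail (v i) , tail e₀ ⟩  ≈⟨ +-cong (*-identityʳ _) (inner-zeroʳ (tail (v i))) ⟩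
      head (v i) + 0#                             ≈⟨ +-identityʳ _ ⟩
      head (v i)                                  ≈⟨ decidable-stable (head (v i) ≈? 0#) (λ vᵢ≉0 → no-pivot (i , i∈Q , vᵢ≉0)) ⟩
      0#                                          ∎
  ... | yes (p , p∈Q , a≉0)
    -- Dropping the pivot row and the first coordinate lowers both sides of the cardinality bound,
    -- so the induction applies to the reduced tails.
    with y , y≉0 , y⊥ ← nonzero-orthogonal
           (λ i → tail (v i) ⊕ (head (v i) * - (head (v p) ⁻¹)) · tail (v p)) (Q ∖ p)
           (ℕ.<-≤-trans (x∈p⇒∣p-x∣<∣p∣ p∈Q) (ℕ.s≤s⁻¹ ∣Q∣<1+d)) =
    x , (λ x≋0 → y≉0 (x≋0 ∘ suc)) , orthogonal
    where
    a m T : Carrier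
    a = head (v p)
    m = - (a ⁻¹)
    T = ⟨ tail (v p) , y ⟩
    x : Space (suc d)
    -- Back substitution: this is the solution of `a * x zero + T ≈ 0#`, the orthogonality condition
    -- for the pivot row.
    x zero    = m * T
    x (suc k) = y k
    am≈-1 : a * m ≈ - 1#
    am≈-1 = trans (sym (-‿distribʳ-* a (a ⁻¹))) (-‿cong (⁻¹-inverse a a≉0))
    orthogonal : ∀ i → i ∈ Q → ⟨ v i , x ⟩ ≈ 0#
    orthogonal i i∈Q with i ≟ p
    ... | yes ≡.refl = begin
      a * (m * T) + T        ≈⟨ +-congʳ (*-assoc a m T) ⟨
      (a * m) * T + T        ≈⟨ +-congʳ (*-congʳ am≈-1) ⟩
      - 1# * T + T           ≈⟨ +-congʳ (-1*x≈-x T) ⟩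
      - T + T                ≈⟨ -‿inverseˡ T ⟩
      0#                     ∎
    -- With this first coordinate, the product with row `i` of the original system equals the
    -- product of the reduced row with `y`.
    ... | no i≢p = begin
      head (v i) * (m * T) + ⟨ tail (v i) , y ⟩
        ≈⟨ solve 4 (λ h m T u → h :* (m :* T) :+ u := u :+ (h :* m) :* T) refl (head (v i)) m T _ ⟩
      ⟨ tail (v i) , y ⟩ + (head (v i) * m) * T
        ≈⟨ inner-⊕-·ˡ (tail (v i)) (head (v i) * m) (tail (v p)) y ⟨
      ⟨ tail (v i) ⊕ (head (v i) * m) · tail (v p) , y ⟩
        ≈⟨ y⊥ i (x∈p∧x≢y⇒x∈p-y i∈Q i≢p) ⟩
      0#  ∎

  unit-nonpositive : ∀ {d n} (v : Fin n → Space d) (Q : Subset n) → Nonempty Q → ∣ Q ∣ ℕ.≤ d →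
                     ∃[ x ] Sphere x × (∀ i → i ∈ Q → ⟨ v i , x ⟩ ≤ 0#)
  unit-nonpositive v Q (q , q∈Q) ∣Q∣≤d
    -- Removing `q` turns the weak bound by `d` into the strict one required for elimination. Only
    -- the sign at `q` then remains to be controlled.
    with x , x≉0 , x⊥ ← nonzero-orthogonal v (Q ∖ q) (ℕ.<-≤-trans (x∈p⇒∣p-x∣<∣p∣ q∈Q) ∣Q∣≤d)
    with c , cx-unit ← normalise x x≉0
    with total ⟨ v q , c · x ⟩ 0#
  ... | inj₁ q≤0 = c · x , cx-unit , nonpositive
    where
    nonpositive : ∀ i → i ∈ Q → ⟨ v i , c · x ⟩ ≤ 0#
    nonpositive i i∈Q with i ≟ q
    ... | yes ≡.refl = q≤0
    ... | no  i≢q    = ≤-reflexive (begin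
      ⟨ v i , c · x ⟩  ≈⟨ inner-·ʳ (v i) c x ⟩
      c * ⟨ v i , x ⟩  ≈⟨ *-congˡ (x⊥ i (x∈p∧x≢y⇒x∈p-y i∈Q i≢q)) ⟩
      c * 0#           ≈⟨ zeroʳ c ⟩
      0#               ∎)
  ... | inj₂ q≥0 = - c · x , -cx-unit , nonpositive
    where
    -cx-unit : Sphere (- c · x)
    -cx-unit = begin
      ⟨ - c · x , - c · x ⟩      ≈⟨ inner-·· (- c) x ⟩
      (- c * - c) * ⟨ x , x ⟩    ≈⟨ *-congʳ (-x*-x≈x*x c) ⟩
      (c * c) * ⟨ x , x ⟩        ≈⟨ inner-·· c x ⟨
      ⟨ c · x , c · x ⟩          ≈⟨ cx-unit ⟩
      1#                         ∎
    nonpositive : ∀ i → i ∈ Q → ⟨ v i , - c · x ⟩ ≤ 0#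
    nonpositive i i∈Q with i ≟ q
    ... | yes ≡.refl = ≤-respˡ-≈ (sym (begin
      ⟨ v q , - c · x ⟩      ≈⟨ inner-·ʳ (v q) (- c) x ⟩
      - c * ⟨ v q , x ⟩      ≈⟨ -‿distribˡ-* c _ ⟨
      - (c * ⟨ v q , x ⟩)    ≈⟨ -‿cong (inner-·ʳ (v q) c x) ⟨
      - ⟨ v q , c · x ⟩      ∎)) (neg-nonpositive q≥0)
    ... | no  i≢q    = ≤-reflexive (begin
      ⟨ v i , - c · x ⟩  ≈⟨ inner-·ʳ (v i) (- c) x ⟩
      - c * ⟨ v i , x ⟩  ≈⟨ *-congˡ (x⊥ i (x∈p∧x≢y⇒x∈p-y i∈Q i≢q)) ⟩
      - c * 0#           ≈⟨ zeroʳ (- c) ⟩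
      0#                 ∎)

-- Size of regret sets and output of the greedy loop.

module RegretSets (ℝ : Reals) {d n : ℕ} (t : Fin n → Euclidean.Space ℝ d) where
  open Reals ℝ hiding (zero)
  open Euclidean ℝ
  open Regret ℝ t
  open OrderedField ℝ
  open InnerProduct ℝ
  open import Algebra.Properties.Ring ring using (-‿distribˡ-*)

  ω-exists : ∀ x (Q : Subset n) → Nonempty Q → ∃[ i ] i ∈ Q × Isω x Q ⟨ t i , x ⟩
  ω-exists x Q Q-nonempty with i , i∈Q , max ← maximum (λ i → ⟨ t i , x ⟩) Q Q-nonempty =
    i , i∈Q , (i , i∈Q , refl) , λ { s (j , j∈Q , s≈) → ≤-respˡ-≈ (sym s≈) (max j j∈Q) }

  -- The maximum regret ratio is attained in some direction, and the value of ω over `Q` in that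
  -- direction is attained at a point of `Q`.
  regret-set-nonempty : ∀ {ε Q} → IsRegretSet ε Q → Nonempty Q
  regret-set-nonempty (_ , ((_ , _ , _ , _ , ((i , i∈Q , _) , _) , _) , _) , _) = i , i∈Q

  1≤regret-ratio : ∀ {w wₚ} → w ≤ 0# → 0# < wₚ → 1# ≤ 1# - w * wₚ ⁻¹
  1≤regret-ratio {w} {wₚ} w≤0 0<wₚ = x≤x+y (≤-respʳ-≈ (sym (-‿distribˡ-* w (wₚ ⁻¹)))
    (*-nonneg (neg-nonneg w≤0) (inj₁ (⁻¹-positive 0<wₚ))))

  d<∣regret-set∣ : StandingCondition → ∀ {ε Q} → ε < 1# → IsRegretSet ε Q → d ℕ.< ∣ Q ∣
  d<∣regret-set∣ standing {ε} {Q} ε<1 regret@(l , (_ , l-upper) , l≤ε) = ℕ.≰⇒> λ ∣Q∣≤d →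
    let Q-nonempty         = regret-set-nonempty regret
        x , x-unit , x≤0   = unit-nonpositive t Q Q-nonempty ∣Q∣≤d
        i , i∈Q , ω-Q      = ω-exists x Q Q-nonempty
        wₚ , ω-P , 0<wₚ    = standing x x-unit
        r≤l                = l-upper _ (x , x-unit , _ , wₚ , ω-Q , ω-P , refl)
    -- The ratio at `x` is at least one and at most `l`, hence at most `ε`, contradicting `ε < 1#`.
    in <⇒≱ ε<1 (≤-trans (1≤regret-ratio (x≤0 i i∈Q) 0<wₚ) (≤-trans r≤l l≤ε))

  module _ {X : Subset n} {N : Fin n → Subset n} {ε : Carrier} where
    open HGRMR X N ε

    -- Loop invariant: each pick adds an element of `X`. The partial solution is kept general so
    -- that induction on the run goes through.
    Greedy-⊆ : ∀ {H Q U Q′} → Q ⊆ X → Greedy H Q U Q′ → Q′ ⊆ X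
    Greedy-⊆ Q⊆X (done _) = Q⊆X
    Greedy-⊆ {Q = Q} Q⊆X (pick i _ i∈X _ _ rest) = Greedy-⊆
      (λ j∈Q∪i → [ Q⊆X , (λ j∈i → ≡.subst (_∈ X) (≡.sym (x∈⁅y⁆⇒x≡y i j∈i)) i∈X) ]′ (x∈p∪q⁻ Q ⁅ i ⁆ j∈Q∪i))
      rest

    Returns-⊆ : ∀ {Q} → Returns Q → Q ⊆ X
    Returns-⊆ (_ , _ , greedy) = Greedy-⊆ (λ j∈⊥ → contradiction j∈⊥ ∉⊥) greedy

-- Passage from natural numbers to rationals.

a≤[b/d]c : ∀ a b c d → a ℕ.* suc d ℕ.≤ b ℕ.* c →
           (+ a ℚ./ 1) ℚ.≤ (+ b ℚ./ suc d) ℚ.* (+ c ℚ./ 1)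
-- Unnormalised fractions keep their denominators unreduced, so there the inequality is plain
-- cross-multiplication of integers.
a≤[b/d]c a b c d ad≤bc = ℚ.toℚᵘ-cancel-≤ (begin
  ℚ.toℚᵘ (+ a ℚ./ 1)                                   ≃⟨ ℚ.toℚᵘ-fromℚᵘ (ℚᵘ.mkℚᵘ (+ a) 0) ⟩
  ℚᵘ.mkℚᵘ (+ a) 0                                      ≤⟨ ℚᵘ.*≤* unnormalised ⟩
  ℚᵘ.mkℚᵘ (+ b) d ℚᵘ.* ℚᵘ.mkℚᵘ (+ c) 0
    ≃⟨ ℚᵘ.*-cong (ℚ.toℚᵘ-fromℚᵘ (ℚᵘ.mkℚᵘ (+ b) d)) (ℚ.toℚᵘ-fromℚᵘ (ℚᵘ.mkℚᵘ (+ c) 0)) ⟨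
  ℚ.toℚᵘ (+ b ℚ./ suc d) ℚᵘ.* ℚ.toℚᵘ (+ c ℚ./ 1)       ≃⟨ ℚ.toℚᵘ-homo-* (+ b ℚ./ suc d) (+ c ℚ./ 1) ⟨
  ℚ.toℚᵘ ((+ b ℚ./ suc d) ℚ.* (+ c ℚ./ 1))             ∎)
  where
  open ℚᵘ.≤-Reasoning
  unnormalised : + a ℤ.* + (suc d ℕ.* 1) ℤ.≤ (+ b ℤ.* + c) ℤ.* + 1
  unnormalised
    rewrite ≡.sym (ℤ.pos-* a (suc d ℕ.* 1)) | ≡.sym (ℤ.pos-* b c)
          | ℤ.*-identityʳ (+ (b ℕ.* c)) | ℕ.*-identityʳ (suc d) = ℤ.+≤+ ad≤bc

theorem5 : (ℝ : Reals) → let open Reals ℝ in let open Euclidean ℝ in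
    (d n : ℕ) (P : Fin n → Space d) → let open Regret ℝ P in
    Distinct → StandingCondition →
    (ε : Carrier) → 0# < ε → ε < 1# →
    (X : Subset n) → IsExtremeSet X →
    (N : Fin n → Subset n) → IsDelaunayGraph X N →
    (Q* : Subset n) → IsOptimal ε Q* →
    (Qε : Subset n) → HGRMR.Returns X N ε Qε →
    (+ ∣ Qε ∣ ℚ./ 1) ℚ.≤ (+ ∣ X ∣ ℚ./ suc d) ℚ.* (+ ∣ Q* ∣ ℚ./ 1)
theorem5 ℝ d n P _ standing ε _ ε<1 X _ N _ Q* (Q*-regret , _) Qε returns =
  -- Two bounds are multiplied: the output has at most as many points as `X`, and `d < ∣ Q* ∣` is by
  -- definition `suc d ≤ ∣ Q* ∣`.
  a≤[b/d]c (∣ Qε ∣) (∣ X ∣) (∣ Q* ∣) d (ℕ.*-mono-≤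
    (p⊆q⇒∣p∣≤∣q∣ (Returns-⊆ returns))
    (d<∣regret-set∣ standing ε<1 Q*-regret))
  where open RegretSets ℝ P
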